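{- Let $G$ be a reducible multigraph. Then the number of degree-$0$ vertices remaining after $G$ has been fully reduced by channel-preserving moves equals $\dim_{\mathbf{Z}/2\mathbf{Z}}\mathcal{C}(G)$; in particular this number does not depend on the sequence of channel-preserving moves used.
   Context: Multigraphs (finite, no self-loops) are allowed; $N(v)$ is the multiset of neighbours of $v$ with multiplicity equal to the number of joining edges. A channel is a vertex set $C$ such that every vertex $v$ has an even number of elements of $N(v)$ (counted with multiplicity) in $C$; $\mathcal{C}(G)$ is the $\mathbf{Z}/2\mathbf{Z}$-vector space of channels under symmetric difference. Channel-preserving moves: (VC) for a vertex $v$ of degree 2 adjacent to distinct $v_1,v_2$, contract both edges at $v$ and delete resulting self-loops; (ED) delete two edges with the same endpoints; (FV) for distinct adjacent $v_1,v_2$ with $\deg v_1=1$, delete $v_1,v_2$ and their incident edges. $G$ is reducible if it can be transformed by a finite sequence of channel-preserving moves into a graph all of whose vertices have degree $0$. -}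

module Defs where

open import Algebra.Bundles using (Ring; CommutativeRing)
open import Algebra.Module.Bundles using (LeftModule)
open import Algebra.Properties.CommutativeMonoid.Sum as Sum using ()
open import Algebra.Properties.Monoid.Sum as MonoidSum using ()
open import Data.Bool.Base using (Bool; true; false; if_then_else_; not; _∧_; _∨_; _xor_)
open import Data.Bool.Properties
  using ( xor-∧-commutativeRing; xor-assoc; xor-comm; xor-identity; xor-same
        ; ∧-distribˡ-xor; ∧-distribʳ-xor; ∧-assoc; ∧-zeroʳ; ∧-comm; ∨-comm )
open import Data.Fin.Base using (Fin)
open import Data.Fin.Properties using (_≟_)
open import Data.Fin.Subset using (Subset) renaming (⊥ to ∅)
open import Data.List.Base using (_∷_; []; length; filter; allFin)
open import Data.List.Membership.Propositional using (_∈_; _∉_)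
open import Data.Nat.Base using (ℕ; _+_; _∸_; _≤_; _<_)
open import Data.Nat.Divisibility using (_∣_; _∣0; ∣m+n∣m⇒∣n; ∣m∣n⇒∣m+n; m∣m*n)
open import Data.Nat.Properties using (+-0-commutativeMonoid)
import Data.Nat.Properties as ℕ
open import Data.Product.Base using (∃; _×_; _,_; proj₁)
open import Data.Sum.Base using (_⊎_)
open import Data.Vec.Base using (lookup; zipWith) renaming (map to mapᵛ)
open import Data.Vec.Functional using (Vector)
import Data.Vec.Properties as Vec
open import Function.Bundles using (_⇔_)
open import Function.Definitions using (Injective; Surjective)
open import Level using (Level; _⊔_; 0ℓ)
open import Relation.Binary.Construct.Closure.ReflexiveTransitive using (Star)
open import Relation.Binary.PropositionalEquality
open import Relation.Nullary.Decidable using (does; yes; no)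
open import Relation.Nullary.Negation using (contradiction)

open Sum +-0-commutativeMonoid using (sum; sum-syntax; sum-cong-≗; sum-replicate-zero; ∑-distrib-+; ∑-comm)

-- A finite multigraph without self-loops, given by its edge multiplicities.

record Multigraph : Set where
  field
    order    : ℕ
    mult     : Fin order → Fin order → ℕ
    mult-sym : ∀ u v → mult u v ≡ mult v u
    no-loops : ∀ v → mult v v ≡ 0

  Vertex : Set
  Vertex = Fin order

  -- The multiset of neighbours of v, as a function from elements to multiplicities.
  N : Vertex → Vector ℕ order
  N = mult

  Adjacent : Vertex → Vertex → Set
  Adjacent u v = 0 < mult u v

  deg : Vertex → ℕ
  deg v = sum (N v)

open Multigraph public

FullyReduced : Multigraph → Set
FullyReduced G = ∀ v → deg G v ≡ 0

#isolated : Multigraph → ℕ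
#isolated G = length (filter (λ v → deg G v ℕ.≟ 0) (allFin (order G)))

-- The identification of vertices of G along π, with all self-loops so
-- created deleted.

onFibres : ∀ (G : Multigraph) {m} → (Vertex G → Fin m) → Fin m → Fin m → Vertex G → Vertex G → ℕ
onFibres G π a b u w = if does (π u ≟ a) ∧ does (π w ≟ b) then mult G u w else 0

quotientMult : ∀ (G : Multigraph) {m} → (Vertex G → Fin m) → Fin m → Fin m → ℕ
quotientMult G π a b =
  if does (a ≟ b) then 0 else ∑[ u < order G ] ∑[ w < order G ] onFibres G π a b u w

quotient : (G : Multigraph) {m : ℕ} → (Vertex G → Fin m) → Multigraph
quotient G {m} π = record
  { order    = m
  ; mult     = quotientMult G π
  ; mult-sym = symm
  ; no-loops = loopless
  }
  where
  fibres-sym : ∀ a b u w → onFibres G π a b u w ≡ onFibres G π b a w u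
  fibres-sym a b u w = cong₂ (λ c k → if c then k else 0)
    (∧-comm (does (π u ≟ a)) (does (π w ≟ b))) (mult-sym G u w)

  symm : ∀ a b → quotientMult G π a b ≡ quotientMult G π b a
  symm a b with a ≟ b | b ≟ a
  ... | yes _   | yes _   = refl
  ... | yes a≡b | no b≢a  = contradiction (sym a≡b) b≢a
  ... | no a≢b  | yes b≡a = contradiction (sym b≡a) a≢b
  ... | no _    | no _    = trans
    (sum-cong-≗ λ u → sum-cong-≗ λ w → fibres-sym a b u w)
    (∑-comm λ u w → onFibres G π b a w u)

  loopless : ∀ a → quotientMult G π a a ≡ 0
  loopless a with a ≟ a
  ... | yes _  = refl
  ... | no a≢a = contradiction refl a≢a

-- The subgraph of G induced on the image of ι.

induced : (G : Multigraph) {m : ℕ} → (Fin m → Vertex G) → Multigraph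
induced G {m} ι = record
  { order    = m
  ; mult     = λ i j → mult G (ι i) (ι j)
  ; mult-sym = λ i j → mult-sym G (ι i) (ι j)
  ; no-loops = λ i → no-loops G (ι i)
  }

joins : ∀ {n} → Fin n → Fin n → Fin n → Fin n → Bool
joins v w x y = (does (x ≟ v) ∧ does (y ≟ w)) ∨ (does (x ≟ w) ∧ does (y ≟ v))

deleteTwoEdges : (G : Multigraph) → Vertex G → Vertex G → Multigraph
deleteTwoEdges G v w = record
  { order    = order G
  ; mult     = μ
  ; mult-sym = symm
  ; no-loops = loopless
  }
  where
  μ : Vertex G → Vertex G → ℕ
  μ x y = if joins v w x y then mult G x y ∸ 2 else mult G x y

  joins-sym : ∀ x y → joins v w x y ≡ joins v w y x
  joins-sym x y = trans (∨-comm (does (x ≟ v) ∧ does (y ≟ w)) _)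
    (cong₂ _∨_ (∧-comm (does (x ≟ w)) _) (∧-comm (does (x ≟ v)) _))

  symm : ∀ x y → μ x y ≡ μ y x
  symm x y = cong₂ (λ b k → if b then k ∸ 2 else k) (joins-sym x y) (mult-sym G x y)

  loopless : ∀ x → μ x x ≡ 0
  loopless x rewrite no-loops G x with joins v w x x
  ... | true  = refl
  ... | false = refl

-- The channel-preserving moves.  The vertices of the graph produced by VC or
-- FV may be numbered arbitrarily: this is the choice of π, respectively ι.

infix 4 _↝_ _↝*_

data _↝_ (G : Multigraph) : Multigraph → Set where

  -- π identifies v, v₁ and v₂ with one another and identifies nothing else.
  VC : ∀ v v₁ v₂ → deg G v ≡ 2 → v₁ ≢ v₂ → Adjacent G v v₁ → Adjacent G v v₂ →
       ∀ {m} (π : Vertex G → Fin m) → Surjective _≡_ _≡_ π →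
       (∀ x y → π x ≡ π y ⇔
         (x ≡ y ⊎ (x ∈ v ∷ v₁ ∷ v₂ ∷ [] × y ∈ v ∷ v₁ ∷ v₂ ∷ []))) →
       G ↝ quotient G π

  ED : ∀ v w → 2 ≤ mult G v w → G ↝ deleteTwoEdges G v w

  FV : ∀ v₁ v₂ → v₁ ≢ v₂ → Adjacent G v₁ v₂ → deg G v₁ ≡ 1 →
       ∀ {m} (ι : Fin m → Vertex G) → Injective _≡_ _≡_ ι →
       (∀ x → (∃ λ i → ι i ≡ x) ⇔ x ∉ v₁ ∷ v₂ ∷ []) →
       G ↝ induced G ι

_↝*_ : Multigraph → Multigraph → Set
_↝*_ = Star _↝_

Reducible : Multigraph → Set
Reducible G = ∃ λ H → G ↝* H × FullyReduced H

-- The number of elements, with multiplicity, of the multiset M lying in C.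

#_in[_] : ∀ {n} → Vector ℕ n → Subset n → ℕ
# M in[ C ] = ∑[ u < _ ] (if lookup C u then M u else 0)

IsChannel : (G : Multigraph) → Subset (order G) → Set
IsChannel G C = ∀ v → 2 ∣ # N G v in[ C ]

Channel : Multigraph → Set
Channel G = ∃ (IsChannel G)

infixl 6 _△_

_△_ : ∀ {n} → Subset n → Subset n → Subset n
_△_ = zipWith _xor_

-- The two-element field, with addition _xor_ and multiplication _∧_.

ℤ/2 : Ring 0ℓ 0ℓ
ℤ/2 = CommutativeRing.ring xor-∧-commutativeRing

module _ {n : ℕ} (M : Vector ℕ n) where

  private
    at : Subset n → Fin n → ℕ
    at C u = if lookup C u then M u else 0

    at-∩ : Subset n → Subset n → Fin n → ℕ
    at-∩ C D u = if lookup C u ∧ lookup D u then M u else 0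

    pointwise : ∀ b c k →
      ((if b ∧ c then k else 0) + (if b ∧ c then k else 0)) + (if b xor c then k else 0)
        ≡ (if b then k else 0) + (if c then k else 0)
    pointwise true  true  k = ℕ.+-identityʳ (k + k)
    pointwise true  false k = sym (ℕ.+-identityʳ k)
    pointwise false c     k = refl

    #-△ : ∀ C D →
      (sum (at-∩ C D) + sum (at-∩ C D)) + # M in[ C △ D ] ≡ # M in[ C ] + # M in[ D ]
    #-△ C D = begin
      (sum i + sum i) + sum (at (C △ D))
        ≡⟨ cong (_+ sum (at (C △ D))) (∑-distrib-+ i i) ⟨
      sum (λ u → i u + i u) + sum (at (C △ D))
        ≡⟨ ∑-distrib-+ (λ u → i u + i u) (at (C △ D)) ⟨
      sum (λ u → (i u + i u) + at (C △ D) u)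
        ≡⟨ sum-cong-≗ eq ⟩
      sum (λ u → at C u + at D u)
        ≡⟨ ∑-distrib-+ (at C) (at D) ⟩
      sum (at C) + sum (at D) ∎
      where
      open ≡-Reasoning
      i = at-∩ C D
      eq : ∀ u → (i u + i u) + at (C △ D) u ≡ at C u + at D u
      eq u rewrite Vec.lookup-zipWith _xor_ u C D = pointwise (lookup C u) (lookup D u) (M u)

    2∣m+m : ∀ m → 2 ∣ m + m
    2∣m+m m = subst (2 ∣_) (cong (m +_) (ℕ.+-identityʳ m)) (m∣m*n m)

  even-△ : ∀ C D → 2 ∣ # M in[ C ] → 2 ∣ # M in[ D ] → 2 ∣ # M in[ C △ D ]
  even-△ C D c d = ∣m+n∣m⇒∣n (subst (2 ∣_) (sym (#-△ C D)) (∣m∣n⇒∣m+n c d)) (2∣m+m (sum (at-∩ C D)))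

  even-∅ : 2 ∣ # M in[ ∅ ]
  even-∅ = subst (2 ∣_) (sym (trans (sum-cong-≗ eq) (sum-replicate-zero n))) (2 ∣0)
    where
    eq : ∀ u → at ∅ u ≡ 0
    eq u rewrite Vec.lookup-replicate u false = refl

-- The ℤ/2-vector space of channels of G under symmetric difference.

𝒞 : Multigraph → LeftModule ℤ/2 0ℓ 0ℓ
𝒞 G = record
  { Carrierᴹ = Channel G
  ; _≈ᴹ_ = λ C D → proj₁ C ≡ proj₁ D
  ; _+ᴹ_ = _⊞_
  ; _*ₗ_ = _·_
  ; 0ᴹ   = 𝟎
  ; -ᴹ_  = λ C → C
  ; isLeftModule = record
    { isLeftSemimodule = record
      { +ᴹ-isCommutativeMonoid = record
        { isMonoid = record
          { isSemigroup = record
            { isMagma = record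
              { isEquivalence = record { refl = refl ; sym = sym ; trans = trans }
              ; ∙-cong = cong₂ _△_
              }
            ; assoc = λ C D E → Vec.zipWith-assoc xor-assoc (proj₁ C) (proj₁ D) (proj₁ E)
            }
          ; identity = (λ C → Vec.zipWith-identityˡ (proj₁ xor-identity) (proj₁ C))
                     , (λ C → △-identityʳ (proj₁ C))
          }
        ; comm = λ C D → Vec.zipWith-comm xor-comm (proj₁ C) (proj₁ D)
        }
      ; isPreleftSemimodule = record
        { *ₗ-cong      = λ { {b} refl C≡D → ·-cong b C≡D }
        ; *ₗ-zeroˡ     = λ _ → refl
        ; *ₗ-distribʳ  = λ C b c → distribʳ C b c
        ; *ₗ-identityˡ = λ _ → refl
        ; *ₗ-assoc     = λ { true _ _ → refl ; false _ _ → refl }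
        ; *ₗ-zeroʳ     = λ { true → refl ; false → refl }
        ; *ₗ-distribˡ  = λ { true _ _ → refl ; false _ _ → sym (△-identityʳ ∅) }
        }
      }
    ; -ᴹ‿cong = λ C≡D → C≡D
    ; -ᴹ‿inverse = (λ C → △-self (proj₁ C)) , (λ C → △-self (proj₁ C))
    }
  }
  where
  _⊞_ : Channel G → Channel G → Channel G
  (C , c) ⊞ (D , d) = C △ D , λ v → even-△ (N G v) C D (c v) (d v)

  𝟎 : Channel G
  𝟎 = ∅ , λ v → even-∅ (N G v)

  _·_ : Bool → Channel G → Channel G
  true  · C = C
  false · C = 𝟎

  ·-cong : ∀ b {C D} → proj₁ C ≡ proj₁ D → proj₁ (b · C) ≡ proj₁ (b · D)
  ·-cong true  C≡D = C≡D
  ·-cong false C≡D = refl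

  △-identityʳ : ∀ {n} (C : Subset n) → C △ ∅ ≡ C
  △-identityʳ C = Vec.zipWith-identityʳ (λ { true → refl ; false → refl }) C

  △-self : ∀ {n} (C : Subset n) → C △ C ≡ ∅
  △-self C = trans (cong (_△ C) (sym (Vec.map-id C))) (Vec.zipWith-inverseˡ xor-same C)

  distribʳ : ∀ C b c → proj₁ ((b xor c) · C) ≡ proj₁ (b · C) △ proj₁ (c · C)
  distribʳ (C , _) true  true  = sym (△-self C)
  distribʳ (C , _) true  false = sym (△-identityʳ C)
  distribʳ (C , _) false true  = sym (Vec.zipWith-identityˡ (proj₁ xor-identity) C)
  distribʳ _       false false = sym (△-identityʳ ∅)

module _ {r ℓr m ℓm : Level} {R : Ring r ℓr} (V : LeftModule R m ℓm) where
  open Ring R using (Carrier; _≈_; 0#)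
  open LeftModule V using (Carrierᴹ; _≈ᴹ_; _*ₗ_; 0ᴹ; +ᴹ-monoid)

  linearCombination : ∀ {d} → Vector Carrier d → Vector Carrierᴹ d → Carrierᴹ
  linearCombination a b = MonoidSum.sum +ᴹ-monoid (λ i → a i *ₗ b i)

  record IsBasis {d : ℕ} (b : Vector Carrierᴹ d) : Set (r ⊔ ℓr ⊔ m ⊔ ℓm) where
    field
      independent : ∀ a → linearCombination a b ≈ᴹ 0ᴹ → ∀ i → a i ≈ 0#
      spanning    : ∀ x → ∃ λ a → linearCombination a b ≈ᴹ x

  HasDimension : ℕ → Set (r ⊔ ℓr ⊔ m ⊔ ℓm)
  HasDimension d = ∃ λ (b : Vector Carrierᴹ d) → IsBasis b

{-# OPTIONS --safe #-}
module Submission where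

-- Over 𝔽₂ the channels of G form the kernel of its adjacency matrix A.  Each
-- move G ↝ H comes with a map σ from the vertices of H to those of G such that
-- C ↦ C ∘ σ is an isomorphism from the kernel for G onto that for H.  For VC,
-- σ is a section of π with value v₁ at the merged vertex: C agrees with
-- (C ∘ σ) ∘ π away from v, and the equation at v₁ determines C v.  For a fully
-- reduced H the kernel is everything, and the bases of a space over 𝔽₂ all
-- have the same size because n coordinates encode 2 ^ n elements.

open import Defs
open import Algebra.Bundles using (CommutativeMonoid; CommutativeRing)
open import Algebra.Module.Bundles using (LeftModule)
import Algebra.Properties.CommutativeMonoid.Sum as CommutativeMonoidSum
import Algebra.Properties.Semiring.Sum as SemiringSum
open import Data.Bool.Base using (Bool; true; false; if_then_else_; not; _∧_; _xor_)
open import Data.Bool.Properties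
  using ( xor-∧-commutativeRing; xor-assoc; xor-identityʳ; xor-same; not-distribˡ-xor; not-involutive
        ; ∧-distribˡ-xor; ∧-distribʳ-xor; ∧-assoc; ∧-comm; ∧-identityʳ; ∧-zeroʳ )
open import Data.Fin.Base as Fin using (Fin; zero; suc; punchIn; funToFin; finToFun)
open import Data.Fin.Properties using (_≟_; 2↔Bool; finToFun-funToFin; funToFin-finToFin; injective⇒≤; punchInᵢ≢i)
open import Data.Fin.Subset using (Subset)
open import Data.List.Base using (_∷_; []; length; allFin)
open import Data.List.Membership.Propositional using (_∈_; _∉_)
open import Data.List.Properties using (filter-all; length-tabulate)
open import Data.List.Relation.Unary.All using (universal)
open import Data.List.Relation.Unary.Any using (here; there)
open import Data.Nat.Base using (ℕ; zero; suc; _+_; _∸_; _*_; _^_; _≤_; z≤n; s≤s)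
open import Data.Nat.Divisibility using (_∣_; divides)
import Data.Nat.Properties as ℕ
open import Data.Product.Base using (∃; _×_; _,_; proj₁; proj₂)
open import Data.Sum.Base using (_⊎_; inj₁; inj₂; [_,_]′)
open import Data.Vec.Base using (lookup; tabulate)
open import Data.Vec.Properties using (lookup∘tabulate; tabulate∘lookup; tabulate-cong; lookup-zipWith; lookup-replicate)
open import Data.Vec.Functional using (Vector)
open import Function.Base using (_∘_; id)
open import Function.Bundles using (_⇔_; Equivalence; Inverse)
open import Function.Definitions using (Injective; Surjective)
open import Level using (0ℓ)
open import Relation.Binary.Construct.Closure.ReflexiveTransitive using (ε; _◅_)
open import Relation.Binary.PropositionalEquality
open import Relation.Nullary.Decidable using (does; yes; no; dec-true; dec-false)
open import Relation.Nullary.Negation using (contradiction)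

-- Finite sums over ℕ and over 𝔽₂

module Σℕ = CommutativeMonoidSum ℕ.+-0-commutativeMonoid
open SemiringSum (CommutativeRing.semiring xor-∧-commutativeRing)

module _ {a ℓ} (M : CommutativeMonoid a ℓ) where
  private
    module M = CommutativeMonoid M
    module S = CommutativeMonoidSum M

  -- Stated for an arbitrary commutative monoid because it serves both the counting sums over ℕ and
  -- the parity sums over 𝔽₂.
  sum-support : ∀ {n} (f : Vector M.Carrier n) v → (∀ u → u ≢ v → f u M.≈ M.ε) → S.sum f M.≈ f v
  sum-support {suc n} f v f≈ε = M.trans (S.sum-remove {i = v} f)
    (M.trans (M.∙-congˡ (M.trans (S.sum-cong-≋ λ i → f≈ε (punchIn v i) (punchInᵢ≢i v i))
                                  (S.sum-replicate-zero n)))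
             (M.identityʳ (f v)))

𝔽₂ : CommutativeMonoid 0ℓ 0ℓ
𝔽₂ = CommutativeRing.+-commutativeMonoid xor-∧-commutativeRing

does-refl : ∀ {n} (u : Fin n) → does (u ≟ u) ≡ true
does-refl u = dec-true (u ≟ u) refl

xor-cancel : ∀ {x y} → x xor y ≡ false → x ≡ y
xor-cancel {true}  {true}  _ = refl
xor-cancel {false} {false} _ = refl

sum-false : ∀ {n} {f : Vector Bool n} → (∀ u → f u ≡ false) → sum f ≡ false
sum-false {n} f≡false = trans (sum-cong-≗ f≡false) (sum-replicate-zero n)

sum-indicator : ∀ {n} (f : Vector Bool n) v → ∑[ u < n ] (does (u ≟ v) ∧ f u) ≡ f v
sum-indicator f v = trans
  (sum-support 𝔽₂ _ v λ u u≢v → cong (_∧ f u) (dec-false (u ≟ v) u≢v))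
  (cong (_∧ f v) (does-refl v))

sum-two-indicators : ∀ {n} (f : Vector Bool n) v w →
  ∑[ u < n ] ((does (u ≟ v) xor does (u ≟ w)) ∧ f u) ≡ f v xor f w
sum-two-indicators f v w = trans
  (sum-cong-≗ λ u → ∧-distribʳ-xor (f u) (does (u ≟ v)) (does (u ≟ w)))
  (trans (∑-distrib-+ (λ u → does (u ≟ v) ∧ f u) (λ u → does (u ≟ w) ∧ f u))
    (cong₂ _xor_ (sum-indicator f v) (sum-indicator f w)))

-- Masking `f` by two indicators changes nothing here. The indicators are added in 𝔽₂ and would
-- cancel at a common point, hence `v ≢ w`.
sum-two-support : ∀ {n} (f : Vector Bool n) v w → v ≢ w →
  (∀ u → u ≢ v → u ≢ w → f u ≡ false) → sum f ≡ f v xor f w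
sum-two-support f v w v≢w f≡false = trans (sum-cong-≗ eq) (sum-two-indicators f v w)
  where
  eq : ∀ u → f u ≡ (does (u ≟ v) xor does (u ≟ w)) ∧ f u
  eq u with u ≟ v | u ≟ w
  ... | yes u≡v | yes u≡w = contradiction (trans (sym u≡v) u≡w) v≢w
  ... | yes _   | no _    = refl
  ... | no _    | yes _   = refl
  ... | no u≢v  | no u≢w  = f≡false u u≢v u≢w

-- Each term is weighted by the number of its preimages under `ι`, which is 1 on the image by
-- injectivity; off the image the term is `false` anyway. Exchanging the two sums finishes.
sum-injection : ∀ {m n} (ι : Fin m → Fin n) → Injective _≡_ _≡_ ι → (f : Vector Bool n) →
  (∀ u → (∃ λ i → ι i ≡ u) ⊎ f u ≡ false) → sum f ≡ ∑[ i < m ] f (ι i)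
sum-injection {m} {n} ι ι-inj f supp = begin
  ∑[ u < n ] f u                                ≡⟨ sum-cong-≗ (sym ∘ fibre) ⟩
  ∑[ u < n ] ∑[ i < m ] (does (u ≟ ι i) ∧ f u)  ≡⟨ ∑-comm (λ u i → does (u ≟ ι i) ∧ f u) ⟩
  ∑[ i < m ] ∑[ u < n ] (does (u ≟ ι i) ∧ f u)  ≡⟨ sum-cong-≗ (λ i → sum-indicator f (ι i)) ⟩
  ∑[ i < m ] f (ι i)                            ∎
  where
  open ≡-Reasoning
  fibre : ∀ u → ∑[ i < m ] (does (u ≟ ι i) ∧ f u) ≡ f u
  fibre u with supp u
  ... | inj₁ (i , refl) = trans
    (sum-support 𝔽₂ _ i λ j j≢i → cong (_∧ f u) (dec-false (ι i ≟ ι j) (j≢i ∘ sym ∘ ι-inj)))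
    (cong (_∧ f u) (does-refl u))
  ... | inj₂ fu = trans
    (sum-false λ i → trans (cong (does (u ≟ ι i) ∧_) fu) (∧-zeroʳ _)) (sym fu)

-- Induction on the size: the first row and the first column agree by symmetry and cancel in pairs,
-- and the corner is a diagonal entry.
sum-alternating : ∀ {n} (B : Fin n → Fin n → Bool) → (∀ u w → B u w ≡ B w u) → (∀ u → B u u ≡ false) →
  ∑[ u < n ] ∑[ w < n ] B u w ≡ false
sum-alternating {zero}  B sym-B diag = refl
sum-alternating {suc n} B sym-B diag = begin
  (B zero zero xor r) xor ∑[ u < n ] (B (suc u) zero xor ∑[ w < n ] B (suc u) (suc w))
    ≡⟨ cong₂ _xor_ (cong (_xor r) (diag zero))
         (∑-distrib-+ (λ u → B (suc u) zero) (λ u → ∑[ w < n ] B (suc u) (suc w))) ⟩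
  r xor (∑[ u < n ] B (suc u) zero xor ∑[ u < n ] ∑[ w < n ] B (suc u) (suc w))
    ≡⟨ cong (r xor_) (cong₂ _xor_ (sum-cong-≗ λ u → sym-B (suc u) zero)
         (sum-alternating (λ u w → B (suc u) (suc w)) (λ u w → sym-B (suc u) (suc w)) (diag ∘ suc))) ⟩
  r xor (r xor false) ≡⟨ cong (r xor_) (xor-identityʳ r) ⟩
  r xor r             ≡⟨ xor-same r ⟩
  false               ∎
  where
  open ≡-Reasoning
  r = ∑[ w < n ] B zero (suc w)

-- Parity

odd : ℕ → Bool
odd zero    = false
odd (suc n) = not (odd n)

odd-+ : ∀ m n → odd (m + n) ≡ odd m xor odd n
odd-+ zero    n = refl
odd-+ (suc m) n = trans (cong not (odd-+ m n)) (not-distribˡ-xor (odd m) (odd n))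

odd-sum : ∀ {n} (f : Vector ℕ n) → odd (Σℕ.sum f) ≡ ∑[ u < n ] odd (f u)
odd-sum {zero}  f = refl
odd-sum {suc n} f = trans (odd-+ (f zero) _) (cong (odd (f zero) xor_) (odd-sum (f ∘ suc)))

odd-∸2 : ∀ {n} → 2 ≤ n → odd (n ∸ 2) ≡ odd n
odd-∸2 {suc (suc n)} _ = sym (not-involutive (odd n))
odd-∸2 {suc zero} (s≤s ())

odd-if : ∀ b k → odd (if b then k else 0) ≡ b ∧ odd k
odd-if true  k = refl
odd-if false k = refl

even⇒¬odd : ∀ {n} → 2 ∣ n → odd n ≡ false
even⇒¬odd (divides q refl) = go q
  where
  go : ∀ q → odd (q * 2) ≡ false
  go zero    = refl
  go (suc q) = trans (not-involutive _) (go q)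

¬odd⇒even : ∀ n → odd n ≡ false → 2 ∣ n
¬odd⇒even zero          _  = divides 0 refl
¬odd⇒even (suc (suc n)) eq with ¬odd⇒even n (trans (sym (not-involutive _)) eq)
... | divides q refl = divides (suc q) refl

sum-mono-≤ : ∀ {n} {f g : Vector ℕ n} → (∀ u → f u ≤ g u) → Σℕ.sum f ≤ Σℕ.sum g
sum-mono-≤ {zero}  f≤g = z≤n
sum-mono-≤ {suc n} f≤g = ℕ.+-mono-≤ (f≤g zero) (sum-mono-≤ (f≤g ∘ suc))

-- A strict inequality at one index cannot be compensated at another. This recovers a whole row of
-- `mult` from its degree and a lower bound with the same total.
≤∧sum≡⇒≗ : ∀ {n} {f g : Vector ℕ n} → (∀ u → f u ≤ g u) → Σℕ.sum f ≡ Σℕ.sum g → f ≗ g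
≤∧sum≡⇒≗ {suc n} {f} {g} f≤g eq = λ where
    zero    → head≡
    (suc u) → ≤∧sum≡⇒≗ (f≤g ∘ suc) tail≡ u
  where
  f⁺ = Σℕ.sum (f ∘ suc)
  g⁺ = Σℕ.sum (g ∘ suc)
  head≡ : f zero ≡ g zero
  head≡ = ℕ.≤-antisym (f≤g zero) (ℕ.+-cancelʳ-≤ f⁺ (g zero) (f zero)
    (ℕ.≤-trans (ℕ.+-monoʳ-≤ (g zero) (sum-mono-≤ (f≤g ∘ suc))) (ℕ.≤-reflexive (sym eq))))
  tail≡ : f⁺ ≡ g⁺
  tail≡ = ℕ.+-cancelˡ-≡ (f zero) f⁺ g⁺ (trans eq (cong (_+ g⁺) (sym head≡)))

indicator : ∀ {n} → Fin n → Vector ℕ n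
indicator v u = if does (u ≟ v) then 1 else 0

sum-indicatorℕ : ∀ {n} (v : Fin n) → Σℕ.sum (indicator v) ≡ 1
sum-indicatorℕ v = trans
  (sum-support ℕ.+-0-commutativeMonoid (indicator v) v λ u u≢v →
    cong (if_then 1 else 0) (dec-false (u ≟ v) u≢v))
  (cong (if_then 1 else 0) (does-refl v))

odd-indicator : ∀ {n} (v u : Fin n) → odd (indicator v u) ≡ does (u ≟ v)
odd-indicator v u = trans (odd-if (does (u ≟ v)) 1) (∧-identityʳ _)

-- The adjacency matrix over 𝔽₂

adj : (G : Multigraph) → Vertex G → Vertex G → Bool
adj G v u = odd (mult G v u)

adj-sym : ∀ G u v → adj G u v ≡ adj G v u
adj-sym G u v = cong odd (mult-sym G u v)

adj-irrefl : ∀ G v → adj G v v ≡ false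
adj-irrefl G v = cong odd (no-loops G v)

Adjacent⇒≢ : ∀ G {v w} → Adjacent G v w → v ≢ w
Adjacent⇒≢ G {v} vw refl = contradiction (no-loops G v) (ℕ.>⇒≢ vw)

-- The indicator of `w` lies below row `v` of `mult`, and both have total 1.
adj-deg-1 : ∀ G {v w} → deg G v ≡ 1 → Adjacent G v w → ∀ u → adj G v u ≡ does (u ≟ w)
adj-deg-1 G {v} {w} deg≡1 vw u =
  trans (cong odd (sym (≤∧sum≡⇒≗ below (trans (sum-indicatorℕ w) (sym deg≡1)) u))) (odd-indicator w u)
  where
  below : ∀ u → indicator w u ≤ mult G v u
  below u with u ≟ w
  ... | yes refl = vw
  ... | no _     = z≤n

-- As for degree 1, with the sum of two indicators as the lower bound of total 2.
adj-deg-2 : ∀ G {v v₁ v₂} → deg G v ≡ 2 → v₁ ≢ v₂ → Adjacent G v v₁ → Adjacent G v v₂ →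
  ∀ u → adj G v u ≡ does (u ≟ v₁) xor does (u ≟ v₂)
adj-deg-2 G {v} {v₁} {v₂} deg≡2 v₁≢v₂ vv₁ vv₂ u = trans
  (cong odd (sym (≤∧sum≡⇒≗ below total u)))
  (trans (odd-+ (indicator v₁ u) (indicator v₂ u)) (cong₂ _xor_ (odd-indicator v₁ u) (odd-indicator v₂ u)))
  where
  below : ∀ u → indicator v₁ u + indicator v₂ u ≤ mult G v u
  below u with u ≟ v₁ | u ≟ v₂
  ... | yes refl | yes u≡v₂ = contradiction u≡v₂ v₁≢v₂
  ... | yes refl | no _     = vv₁
  ... | no _     | yes refl = vv₂
  ... | no _     | no _     = z≤n
  total : Σℕ.sum (λ u → indicator v₁ u + indicator v₂ u) ≡ deg G v
  total = trans (Σℕ.∑-distrib-+ (indicator v₁) (indicator v₂))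
    (trans (cong₂ _+_ (sum-indicatorℕ v₁) (sum-indicatorℕ v₂)) (sym deg≡2))

nbrs : (G : Multigraph) → (Vertex G → Bool) → Vertex G → Bool
nbrs G c v = ∑[ u < order G ] (adj G v u ∧ c u)

Kernel : (G : Multigraph) → (Vertex G → Bool) → Set
Kernel G c = ∀ v → nbrs G c v ≡ false

nbrs-cong : ∀ G {c d} → c ≗ d → nbrs G c ≗ nbrs G d
nbrs-cong G c≗d v = sum-cong-≗ λ u → cong (adj G v u ∧_) (c≗d u)

nbrs-xor : ∀ G c d v → nbrs G (λ u → c u xor d u) v ≡ nbrs G c v xor nbrs G d v
nbrs-xor G c d v = trans (sum-cong-≗ λ u → ∧-distribˡ-xor (adj G v u) (c u) (d u))
  (∑-distrib-+ (λ u → adj G v u ∧ c u) (λ u → adj G v u ∧ d u))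

-- The correction at a single vertex from which channels of the larger graph are built in both FV
-- and VC.
toggle : ∀ {n} → Bool → Fin n → (Fin n → Bool) → Fin n → Bool
toggle e v c u = c u xor (does (u ≟ v) ∧ e)

toggle-minimal : ∀ {n} e (v : Fin n) c {u} → u ≢ v → toggle e v c u ≡ c u
toggle-minimal e v c {u} u≢v =
  trans (cong (λ b → c u xor (b ∧ e)) (dec-false (u ≟ v) u≢v)) (xor-identityʳ _)

nbrs-toggle : ∀ G e v c w → nbrs G (toggle e v c) w ≡ nbrs G c w xor (adj G w v ∧ e)
nbrs-toggle G e v c w = trans (nbrs-xor G c _ w) (cong (nbrs G c w xor_) (trans
  (sum-support 𝔽₂ _ v λ u u≢v →
    trans (cong (λ b → adj G w u ∧ (b ∧ e)) (dec-false (u ≟ v) u≢v)) (∧-zeroʳ _))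
  (cong (λ b → adj G w v ∧ (b ∧ e)) (does-refl v))))

odd-# : ∀ {n} (M : Vector ℕ n) C → odd (# M in[ C ]) ≡ ∑[ u < n ] (odd (M u) ∧ lookup C u)
odd-# M C = trans (odd-sum (λ u → if lookup C u then M u else 0))
  (sum-cong-≗ λ u → trans (odd-if (lookup C u) (M u)) (∧-comm (lookup C u) _))

channel⇒kernel : ∀ G (C : Channel G) → Kernel G (lookup (proj₁ C))
channel⇒kernel G (C , ch) v = trans (sym (odd-# (N G v) C)) (even⇒¬odd (ch v))

kernel⇒channel : ∀ G {c} → Kernel G c → Channel G
kernel⇒channel G {c} k = tabulate c , λ v →
  ¬odd⇒even _ (trans (odd-# (N G v) (tabulate c)) (trans (nbrs-cong G (lookup∘tabulate c) v) (k v)))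

-- Restriction of channels along the moves

-- `faithful` is injectivity in the form of a trivial kernel and `extends` is surjectivity, so C ↦ C
-- ∘ σ is an isomorphism. Labellings are functions here, which makes composing restrictions a
-- composition of the maps σ.
record Restriction (G H : Multigraph) (σ : Vertex H → Vertex G) : Set where
  field
    restricts : ∀ {c} → Kernel G c → Kernel H (c ∘ σ)
    faithful  : ∀ {c} → Kernel G c → (∀ i → c (σ i) ≡ false) → ∀ u → c u ≡ false
    extends   : ∀ {d} → Kernel H d → ∃ λ c → Kernel G c × c ∘ σ ≗ d

open Restriction

restriction-id : ∀ {G} → Restriction G G id
restriction-id = record
  { restricts = id ; faithful = λ _ z → z ; extends = λ k → _ , k , λ _ → refl }

restriction-∘ : ∀ {G H K σ τ} → Restriction G H σ → Restriction H K τ → Restriction G K (σ ∘ τ)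
restriction-∘ {τ = τ} R S = record
  { restricts = restricts S ∘ restricts R
  ; faithful  = λ k z → faithful R k (faithful S (restricts R k) z)
  ; extends   = λ k → let c , kc , c≗ = extends S k
                          c′ , kc′ , c′≗ = extends R kc
                      in c′ , kc′ , λ i → trans (c′≗ (τ i)) (c≗ i)
  }

-- Removing two parallel edges preserves the parity of every multiplicity, so both graphs have the
-- same adjacency matrix over 𝔽₂.
ED-restriction : ∀ G {v w} → 2 ≤ mult G v w → Restriction G (deleteTwoEdges G v w) id
ED-restriction G {v} {w} 2≤vw = record
  { restricts = λ {c} k x → trans (same c x) (k x)
  ; faithful  = λ _ z → z
  ; extends   = λ {d} k → d , (λ x → trans (sym (same d x)) (k x)) , λ _ → refl
  }
  where
  H = deleteTwoEdges G v w

  adj-same : ∀ x y → adj H x y ≡ adj G x y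
  adj-same x y with x ≟ v | y ≟ w | x ≟ w | y ≟ v
  ... | yes refl | yes refl | _        | _        = odd-∸2 2≤vw
  ... | yes refl | no _     | yes refl | yes refl = odd-∸2 2≤vw
  ... | yes refl | no _     | yes refl | no _     = refl
  ... | yes refl | no _     | no _     | _        = refl
  -- The pair is met in the reversed order `w`, `v`, so the bound has to be transported by symmetry.
  ... | no _     | _        | yes refl | yes refl = odd-∸2 (subst (2 ≤_) (mult-sym G v w) 2≤vw)
  ... | no _     | _        | yes refl | no _     = refl
  ... | no _     | _        | no _     | _        = refl

  same : ∀ c x → nbrs H c x ≡ nbrs G c x
  same c x = sum-cong-≗ λ y → cong (_∧ c y) (adj-same x y)

-- The move FV: deleting a vertex of degree 1 and its neighbour

module _ (G : Multigraph) {v₁ v₂} (v₁v₂ : Adjacent G v₁ v₂) (deg≡1 : deg G v₁ ≡ 1)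
         {m} (ι : Fin m → Vertex G) (ι-inj : Injective _≡_ _≡_ ι)
         (image : ∀ x → (∃ λ i → ι i ≡ x) ⇔ x ∉ v₁ ∷ v₂ ∷ []) where
  private
    H = induced G ι

    ι≢v₁ : ∀ i → ι i ≢ v₁
    ι≢v₁ i eq = Equivalence.to (image (ι i)) (i , refl) (here eq)

    ι≢v₂ : ∀ i → ι i ≢ v₂
    ι≢v₂ i eq = Equivalence.to (image (ι i)) (i , refl) (there (here eq))

    data Position : Vertex G → Set where
      first  : Position v₁
      second : Position v₂
      kept   : ∀ i → Position (ι i)

    position : ∀ u → Position u
    position u with u ≟ v₁ | u ≟ v₂
    ... | yes refl | _        = first
    ... | no _     | yes refl = second
    ... | no u≢v₁  | no u≢v₂ with Equivalence.from (image u) (λ where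
                                      (here eq) → u≢v₁ eq
                                      (there (here eq)) → u≢v₂ eq)
    ...   | i , refl = kept i

    adj-v₁ : ∀ u → adj G v₁ u ≡ does (u ≟ v₂)
    adj-v₁ = adj-deg-1 G deg≡1 v₁v₂

    adj-ι-v₁ : ∀ i → adj G (ι i) v₁ ≡ false
    adj-ι-v₁ i = trans (adj-sym G (ι i) v₁) (trans (adj-v₁ (ι i)) (dec-false (ι i ≟ v₂) (ι≢v₂ i)))

    adj-v₂-v₁ : adj G v₂ v₁ ≡ true
    adj-v₂-v₁ = trans (adj-sym G v₂ v₁) (trans (adj-v₁ v₂) (does-refl v₂))

    nbrs-v₁ : ∀ c → nbrs G c v₁ ≡ c v₂
    nbrs-v₁ c = trans (sum-cong-≗ λ u → cong (_∧ c u) (adj-v₁ u)) (sum-indicator c v₂)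

    -- Neither deleted vertex contributes: `v₁` is not adjacent to `ι i`, and `c` vanishes at `v₂`.
    nbrs-ι : ∀ c → c v₂ ≡ false → ∀ i → nbrs G c (ι i) ≡ nbrs H (c ∘ ι) i
    nbrs-ι c cv₂ i = sum-injection ι ι-inj _ supp
      where
      supp : ∀ u → (∃ λ j → ι j ≡ u) ⊎ adj G (ι i) u ∧ c u ≡ false
      supp u with position u
      ... | first  = inj₂ (cong (_∧ c v₁) (adj-ι-v₁ i))
      ... | second = inj₂ (trans (cong (adj G (ι i) v₂ ∧_) cv₂) (∧-zeroʳ _))
      ... | kept j = inj₁ (j , refl)

    module _ {c} (k : Kernel G c) where
      kernel-v₂ : c v₂ ≡ false
      kernel-v₂ = trans (sym (nbrs-v₁ c)) (k v₁)

      -- In the equation at `v₂` all kept vertices contribute nothing and there is no loop, so only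
      -- the term of `v₁` survives, with coefficient 1.
      kernel-v₁ : (∀ i → c (ι i) ≡ false) → c v₁ ≡ false
      kernel-v₁ z = trans (cong (_∧ c v₁) (sym adj-v₂-v₁)) (trans (sym (sum-support 𝔽₂ _ v₁ off)) (k v₂))
        where
        off : ∀ u → u ≢ v₁ → adj G v₂ u ∧ c u ≡ false
        off u u≢v₁ with position u
        ... | first  = contradiction refl u≢v₁
        ... | second = cong (_∧ c v₂) (adj-irrefl G v₂)
        ... | kept i = trans (cong (adj G v₂ (ι i) ∧_) (z i)) (∧-zeroʳ _)

    module _ {d} (k : Kernel H d) where
      -- Extension of `d` by zero to the two deleted vertices.
      d₀ : Vertex G → Bool
      d₀ u = ∑[ i < m ] (does (ι i ≟ u) ∧ d i)

      d₀-ι : d₀ ∘ ι ≗ d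
      d₀-ι i = trans
        (sum-support 𝔽₂ _ i λ j j≢i → cong (_∧ d j) (dec-false (ι j ≟ ι i) (j≢i ∘ ι-inj)))
        (cong (_∧ d i) (does-refl (ι i)))

      d₀-v₂ : d₀ v₂ ≡ false
      d₀-v₂ = sum-false λ i → cong (_∧ d i) (dec-false (ι i ≟ v₂) (ι≢v₂ i))

      -- The extension by zero can fail only the equation at `v₂`. Over 𝔽₂ the vertex `v₁` is seen
      -- from `v₂` alone, so the defect there is the right value at `v₁` and spoils no other
      -- equation.
      extension : Vertex G → Bool
      extension = toggle (nbrs G d₀ v₂) v₁ d₀

      extension-kernel : Kernel G extension
      extension-kernel u = trans (nbrs-toggle G (nbrs G d₀ v₂) v₁ d₀ u) (go (position u))
        where
        go : ∀ {u} → Position u → nbrs G d₀ u xor (adj G u v₁ ∧ nbrs G d₀ v₂) ≡ false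
        go first    = cong₂ (λ x y → x xor (y ∧ nbrs G d₀ v₂)) (trans (nbrs-v₁ d₀) d₀-v₂) (adj-irrefl G v₁)
        go second   = trans (cong (λ y → nbrs G d₀ v₂ xor (y ∧ nbrs G d₀ v₂)) adj-v₂-v₁) (xor-same (nbrs G d₀ v₂))
        go (kept i) = cong₂ (λ x y → x xor (y ∧ nbrs G d₀ v₂))
          (trans (nbrs-ι d₀ d₀-v₂ i) (trans (nbrs-cong H d₀-ι i) (k i))) (adj-ι-v₁ i)

  FV-restriction : Restriction G H ι
  FV-restriction = record
    { restricts = λ {c} k i → trans (sym (nbrs-ι c (kernel-v₂ k) i)) (k (ι i))
    ; faithful  = λ {c} k z u → go k z (position u)
    ; extends   = λ k → extension k , extension-kernel k , λ i →
        trans (toggle-minimal _ v₁ (d₀ k) (ι≢v₁ i)) (d₀-ι k i)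
    }
    where
    go : ∀ {c} → Kernel G c → (∀ i → c (ι i) ≡ false) → ∀ {u} → Position u → c u ≡ false
    go k z first    = kernel-v₁ k z
    go k z second   = kernel-v₂ k
    go k z (kept i) = z i

-- The move VC: quotients and contraction at a vertex of degree 2

fibreSum : ∀ {n m} → (Fin n → Fin m) → (Fin n → Bool) → Fin m → Bool
fibreSum {n} π f a = ∑[ u < n ] (does (π u ≟ a) ∧ f u)

-- Over 𝔽₂ the adjacency matrix of a quotient is PᵀAP, where P is the incidence
-- matrix of π: deleting the loops costs nothing, as PᵀAP is alternating.
nbrs-quotient : ∀ G {m} (π : Vertex G → Fin m) d a →
  nbrs (quotient G π) d a ≡ fibreSum π (nbrs G (d ∘ π)) a
nbrs-quotient G {m} π d a = begin
  ∑[ b < m ] (odd (quotientMult G π a b) ∧ d b)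
    ≡⟨ sum-cong-≗ (λ b → cong (_∧ d b) (entry b)) ⟩
  ∑[ b < m ] ((∑[ u < n ] ∑[ w < n ] X b u w) ∧ d b)
    ≡⟨ sum-cong-≗ (λ b → trans (*-distribʳ-sum (d b) (λ u → ∑[ w < n ] X b u w))
         (sum-cong-≗ λ u → *-distribʳ-sum (d b) (X b u))) ⟩
  ∑[ b < m ] ∑[ u < n ] ∑[ w < n ] (X b u w ∧ d b)
    ≡⟨ ∑-comm (λ b u → ∑[ w < n ] (X b u w ∧ d b)) ⟩
  ∑[ u < n ] ∑[ b < m ] ∑[ w < n ] (X b u w ∧ d b)
    ≡⟨ sum-cong-≗ (λ u → ∑-comm (λ b w → X b u w ∧ d b)) ⟩
  ∑[ u < n ] ∑[ w < n ] ∑[ b < m ] (X b u w ∧ d b)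
    ≡⟨ sum-cong-≗ (λ u → sum-cong-≗ (fibre u)) ⟩
  ∑[ u < n ] ∑[ w < n ] (does (π u ≟ a) ∧ (adj G u w ∧ d (π w)))
    ≡⟨ sum-cong-≗ (λ u → *-distribˡ-sum (does (π u ≟ a)) (λ w → adj G u w ∧ d (π w))) ⟨
  ∑[ u < n ] (does (π u ≟ a) ∧ nbrs G (d ∘ π) u) ∎
  where
  open ≡-Reasoning
  n = order G

  X : Fin m → Vertex G → Vertex G → Bool
  X b u w = (does (π u ≟ a) ∧ does (π w ≟ b)) ∧ adj G u w

  entry : ∀ b → odd (quotientMult G π a b) ≡ ∑[ u < n ] ∑[ w < n ] X b u w
  entry b with a ≟ b
  ... | yes refl = sym (sum-alternating (X a)
    (λ u w → cong₂ _∧_ (∧-comm (does (π u ≟ a)) _) (adj-sym G u w))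
    (λ u → trans (cong ((does (π u ≟ a) ∧ does (π u ≟ a)) ∧_) (adj-irrefl G u)) (∧-zeroʳ _)))
  ... | no _ = trans (odd-sum (λ u → Σℕ.sum (onFibres G π a b u))) (sum-cong-≗ λ u →
    trans (odd-sum (onFibres G π a b u)) (sum-cong-≗ λ w → odd-if (does (π u ≟ a) ∧ does (π w ≟ b)) (mult G u w)))

  fibre : ∀ u w → ∑[ b < m ] (X b u w ∧ d b) ≡ does (π u ≟ a) ∧ (adj G u w ∧ d (π w))
  fibre u w = trans
    (sum-support 𝔽₂ _ (π w) λ b b≢πw → cong (λ y → (y ∧ adj G u w) ∧ d b)
      (trans (cong (does (π u ≟ a) ∧_) (dec-false (π w ≟ b) (b≢πw ∘ sym))) (∧-zeroʳ _)))
    (trans (cong (λ y → ((does (π u ≟ a) ∧ y) ∧ adj G u w) ∧ d (π w)) (does-refl (π w)))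
    (trans (cong (λ y → (y ∧ adj G u w) ∧ d (π w)) (∧-identityʳ (does (π u ≟ a))))
           (∧-assoc (does (π u ≟ a)) _ _)))

module _ (G : Multigraph) {v v₁ v₂} (deg≡2 : deg G v ≡ 2) (v₁≢v₂ : v₁ ≢ v₂)
         (vv₁ : Adjacent G v v₁) (vv₂ : Adjacent G v v₂)
         {m} (π : Vertex G → Fin m) (π-surj : Surjective _≡_ _≡_ π)
         (π-fibres : ∀ x y → π x ≡ π y ⇔
           (x ≡ y ⊎ (x ∈ v ∷ v₁ ∷ v₂ ∷ [] × y ∈ v ∷ v₁ ∷ v₂ ∷ []))) where
  private
    H = quotient G π

    v≢v₁ : v ≢ v₁
    v≢v₁ = Adjacent⇒≢ G vv₁

    πv₁≡πv : π v₁ ≡ π v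
    πv₁≡πv = Equivalence.from (π-fibres v₁ v) (inj₂ (there (here refl) , here refl))

    πv₂≡πv : π v₂ ≡ π v
    πv₂≡πv = Equivalence.from (π-fibres v₂ v) (inj₂ (there (there (here refl)) , here refl))

    π-injective : ∀ {x y} → y ∉ v ∷ v₁ ∷ v₂ ∷ [] → π x ≡ π y → x ≡ y
    π-injective {x} {y} y∉ eq = [ id , (λ (_ , y∈) → contradiction y∈ y∉) ]′ (Equivalence.to (π-fibres x y) eq)

    data Position : Vertex G → Set where
      centre : Position v
      left   : Position v₁
      right  : Position v₂
      other  : ∀ {u} → u ∉ v ∷ v₁ ∷ v₂ ∷ [] → Position u

    position : ∀ u → Position u
    position u with u ≟ v | u ≟ v₁ | u ≟ v₂
    ... | yes refl | _        | _        = centre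
    ... | no _     | yes refl | _        = left
    ... | no _     | no _     | yes refl = right
    ... | no u≢v   | no u≢v₁  | no u≢v₂  = other λ where
      (here eq)                 → u≢v eq
      (there (here eq))         → u≢v₁ eq
      (there (there (here eq))) → u≢v₂ eq

    -- The preimage supplied by `π-surj` for the merged vertex could be `v`, whose value is
    -- independent of the common value at `v₁` and `v₂`; hence the explicit choice of `v₁`.
    σ : Fin m → Vertex G
    σ a = if does (a ≟ π v) then v₁ else proj₁ (π-surj a)

    σ-πv : σ (π v) ≡ v₁
    σ-πv = cong (if_then v₁ else proj₁ (π-surj (π v))) (does-refl (π v))

    π-σ : ∀ a → π (σ a) ≡ a
    π-σ a with a ≟ π v
    ... | yes refl = πv₁≡πv
    ... | no _     = proj₂ (π-surj a) refl

    -- If `σ a` were `v`, then `a` would be `π v`, which `σ` sends to `v₁`.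
    σ≢v : ∀ a → σ a ≢ v
    σ≢v a σa≡v = v≢v₁ (trans (sym σa≡v) (trans (cong σ (trans (sym (π-σ a)) (cong π σa≡v))) σ-πv))

    adj-v : ∀ u → adj G v u ≡ does (u ≟ v₁) xor does (u ≟ v₂)
    adj-v = adj-deg-2 G deg≡2 v₁≢v₂ vv₁ vv₂

    adj-v₁-v : adj G v₁ v ≡ true
    adj-v₁-v = trans (adj-sym G v₁ v) (trans (adj-v v₁) (cong₂ _xor_ (does-refl v₁) (dec-false (v₁ ≟ v₂) v₁≢v₂)))

    adj-v₂-v : adj G v₂ v ≡ true
    adj-v₂-v = trans (adj-sym G v₂ v) (trans (adj-v v₂) (cong₂ _xor_ (dec-false (v₂ ≟ v₁) (v₁≢v₂ ∘ sym)) (does-refl v₂)))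

    adj-other-v : ∀ {u} → u ∉ v ∷ v₁ ∷ v₂ ∷ [] → adj G u v ≡ false
    adj-other-v {u} u∉ = trans (adj-sym G u v) (trans (adj-v u) (cong₂ _xor_
      (dec-false (u ≟ v₁) (u∉ ∘ there ∘ here)) (dec-false (u ≟ v₂) (u∉ ∘ there ∘ there ∘ here))))

    nbrs-v : ∀ c → nbrs G c v ≡ c v₁ xor c v₂
    nbrs-v c = trans (sum-cong-≗ λ u → cong (_∧ c u) (adj-v u)) (sum-two-indicators c v₁ v₂)

    fibreSum-other : ∀ f {u} → u ∉ v ∷ v₁ ∷ v₂ ∷ [] → fibreSum π f (π u) ≡ f u
    fibreSum-other f {u} u∉ = trans
      (sum-support 𝔽₂ _ u λ w w≢u → cong (_∧ f w) (dec-false (π w ≟ π u) (w≢u ∘ π-injective u∉)))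
      (cong (_∧ f u) (does-refl (π u)))

    -- The fibre over the merged vertex consists of `v`, `v₁` and `v₂`, and the first contributes
    -- nothing.
    fibreSum-merged : ∀ f → f v ≡ false → fibreSum π f (π v) ≡ f v₁ xor f v₂
    fibreSum-merged f fv = trans (sum-two-support _ v₁ v₂ v₁≢v₂ off) (cong₂ _xor_
      (cong (_∧ f v₁) (dec-true (π v₁ ≟ π v) πv₁≡πv)) (cong (_∧ f v₂) (dec-true (π v₂ ≟ π v) πv₂≡πv)))
      where
      off : ∀ u → u ≢ v₁ → u ≢ v₂ → does (π u ≟ π v) ∧ f u ≡ false
      off u u≢v₁ u≢v₂ with position u
      ... | centre   = trans (cong (does (π v ≟ π v) ∧_) fv) (∧-zeroʳ _)
      ... | left     = contradiction refl u≢v₁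
      ... | right    = contradiction refl u≢v₂
      ... | other u∉ = cong (_∧ f u) (dec-false (π u ≟ π v) (u∉ ∘ here ∘ sym ∘ π-injective u∉ ∘ sym))

    module _ {c} (k : Kernel G c) where
      c-v₁≡c-v₂ : c v₁ ≡ c v₂
      c-v₁≡c-v₂ = xor-cancel (trans (sym (nbrs-v c)) (k v))

      σ∘π-away : ∀ {u} → u ≢ v → c (σ (π u)) ≡ c u
      σ∘π-away {u} u≢v with position u
      ... | centre   = contradiction refl u≢v
      ... | left     = cong c (trans (cong σ πv₁≡πv) σ-πv)
      ... | right    = trans (cong c (trans (cong σ πv₂≡πv) σ-πv)) c-v₁≡c-v₂
      ... | other u∉ = cong c (π-injective u∉ (π-σ (π u)))

      -- Going down and back up replaces the value at `v` by the one at `v₁` and, because `c` agrees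
      -- at `v₁` and `v₂`, changes nothing else.
      σ∘π-toggle : c ∘ σ ∘ π ≗ toggle (c v xor c v₁) v c
      σ∘π-toggle u with u ≟ v
      ... | yes refl = trans (cong c σ-πv) (trans (cong (_xor c v₁) (sym (xor-same (c v)))) (xor-assoc (c v) (c v) (c v₁)))
      ... | no u≢v   = trans (σ∘π-away u≢v) (sym (xor-identityʳ (c u)))

      -- The change at `v` disturbs the equations of `G` at `v₁` and `v₂` only, each by `e`. By
      -- `nbrs-quotient` an equation of `H` adds up those of a fibre.
      restricted : Kernel H (c ∘ σ)
      restricted a = begin
        nbrs H (c ∘ σ) a
          ≡⟨ nbrs-quotient G π (c ∘ σ) a ⟩
        fibreSum π (nbrs G (c ∘ σ ∘ π)) a
          ≡⟨ sum-cong-≗ (λ u → cong (does (π u ≟ a) ∧_) (flow u)) ⟩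
        ∑[ u < order G ] (does (π u ≟ a) ∧ ((does (u ≟ v₁) xor does (u ≟ v₂)) ∧ e))
          ≡⟨ sum-cong-≗ (λ u → trans (sym (∧-assoc (does (π u ≟ a)) _ e))
               (trans (cong (_∧ e) (∧-comm (does (π u ≟ a)) _)) (∧-assoc (does (u ≟ v₁) xor does (u ≟ v₂)) _ e))) ⟩
        ∑[ u < order G ] ((does (u ≟ v₁) xor does (u ≟ v₂)) ∧ (does (π u ≟ a) ∧ e))
          ≡⟨ sum-two-indicators (λ u → does (π u ≟ a) ∧ e) v₁ v₂ ⟩
        (does (π v₁ ≟ a) ∧ e) xor (does (π v₂ ≟ a) ∧ e)
          -- Both disturbances fall into the same fibre, so they cancel.
          ≡⟨ cong (λ b → (does (b ≟ a) ∧ e) xor (does (π v₂ ≟ a) ∧ e)) (trans πv₁≡πv (sym πv₂≡πv)) ⟩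
        (does (π v₂ ≟ a) ∧ e) xor (does (π v₂ ≟ a) ∧ e)
          ≡⟨ xor-same (does (π v₂ ≟ a) ∧ e) ⟩
        false ∎
        where
        open ≡-Reasoning
        e = c v xor c v₁
        flow : ∀ u → nbrs G (c ∘ σ ∘ π) u ≡ (does (u ≟ v₁) xor does (u ≟ v₂)) ∧ e
        flow u = trans (nbrs-cong G σ∘π-toggle u) (trans (nbrs-toggle G e v c u)
          (cong₂ (λ x y → x xor (y ∧ e)) (k u) (trans (adj-sym G u v) (adj-v u))))

      -- Away from `v` the values are those of `c ∘ σ`; at `v` the equation at `v₁`, where `v` has
      -- coefficient 1, decides.
      vanishing : (∀ a → c (σ a) ≡ false) → ∀ u → c u ≡ false
      vanishing z u with u ≟ v
      ... | no u≢v   = trans (sym (σ∘π-away u≢v)) (z (π u))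
      ... | yes refl = trans (cong (_∧ c v) (sym adj-v₁-v)) (trans (sym (sum-support 𝔽₂ _ v off)) (k v₁))
        where
        off : ∀ w → w ≢ v → adj G v₁ w ∧ c w ≡ false
        off w w≢v = trans (cong (adj G v₁ w ∧_) (trans (sym (σ∘π-away w≢v)) (z (π w)))) (∧-zeroʳ _)

    module _ {d} (k : Kernel H d) where
      flow : Vertex G → Bool
      flow = nbrs G (d ∘ π)

      flow-v : flow v ≡ false
      flow-v = trans (nbrs-v (d ∘ π))
        (trans (cong₂ (λ a b → d a xor d b) πv₁≡πv πv₂≡πv) (xor-same (d (π v))))

      -- The equation of `H` at the merged vertex is the sum of `flow` over the fibre, to which `v`
      -- contributes nothing.
      flow-v₁≡flow-v₂ : flow v₁ ≡ flow v₂
      flow-v₁≡flow-v₂ = xor-cancel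
        (trans (sym (fibreSum-merged flow flow-v)) (trans (sym (nbrs-quotient G π d (π v))) (k (π v))))

      -- The pullback `d ∘ π` can fail only the equations at `v₁` and `v₂`, and by the same amount.
      -- Adding that amount at `v`, their common neighbour, repairs both.
      extension : Vertex G → Bool
      extension = toggle (flow v₁) v (d ∘ π)

      extension-kernel : Kernel G extension
      extension-kernel u = trans (nbrs-toggle G (flow v₁) v (d ∘ π) u) (go (position u))
        where
        go : ∀ {u} → Position u → flow u xor (adj G u v ∧ flow v₁) ≡ false
        go centre = cong₂ (λ x y → x xor (y ∧ flow v₁)) flow-v (adj-irrefl G v)
        go left   = trans (cong (λ y → flow v₁ xor (y ∧ flow v₁)) adj-v₁-v) (xor-same (flow v₁))
        go right  = trans (cong₂ (λ x y → x xor (y ∧ flow v₁)) (sym flow-v₁≡flow-v₂) adj-v₂-v) (xor-same (flow v₁))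
        go (other {u} u∉) = cong₂ (λ x y → x xor (y ∧ flow v₁))
          (trans (sym (fibreSum-other flow u∉)) (trans (sym (nbrs-quotient G π d (π u))) (k (π u))))
          (adj-other-v u∉)

  VC-restriction : Restriction G H σ
  VC-restriction = record
    { restricts = restricted
    ; faithful  = vanishing
    ; extends   = λ {d} k → extension k , extension-kernel k , λ a →
        trans (toggle-minimal _ v (d ∘ π) (σ≢v a)) (cong d (π-σ a))
    }

↝-restriction : ∀ {G H} → G ↝ H → ∃ (Restriction G H)
↝-restriction {G} (VC _ _ _ deg≡2 v₁≢v₂ vv₁ vv₂ π π-surj π-fibres) =
  _ , VC-restriction G deg≡2 v₁≢v₂ vv₁ vv₂ π π-surj π-fibres
↝-restriction {G} (ED _ _ 2≤vw) = _ , ED-restriction G 2≤vw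
↝-restriction {G} (FV _ _ _ v₁v₂ deg≡1 ι ι-inj image) = _ , FV-restriction G v₁v₂ deg≡1 ι ι-inj image

↝*-restriction : ∀ {G H} → G ↝* H → ∃ (Restriction G H)
↝*-restriction ε        = _ , restriction-id
↝*-restriction (x ◅ xs) = _ , restriction-∘ (proj₂ (↝-restriction x)) (proj₂ (↝*-restriction xs))

-- Dimension

lookup-injective : ∀ {n} {C D : Subset n} → lookup C ≗ lookup D → C ≡ D
lookup-injective {C = C} {D} C≗D = trans (sym (tabulate∘lookup C)) (trans (tabulate-cong C≗D) (tabulate∘lookup D))

lookup-linearCombination : ∀ G {n} (a : Vector Bool n) (b : Vector (Channel G) n) u →
  lookup (proj₁ (linearCombination (𝒞 G) a b)) u ≡ ∑[ i < n ] (a i ∧ lookup (proj₁ (b i)) u)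
lookup-linearCombination G {zero}  a b u = lookup-replicate u false
lookup-linearCombination G {suc n} a b u = trans
  (lookup-zipWith _xor_ u (proj₁ (a zero *ₗ b zero)) _)
  (cong₂ _xor_ (scale (a zero)) (lookup-linearCombination G (a ∘ suc) (b ∘ suc) u))
  where
  open LeftModule (𝒞 G)
  scale : ∀ e → lookup (proj₁ (e *ₗ b zero)) u ≡ e ∧ lookup (proj₁ (b zero)) u
  scale true  = refl
  scale false = lookup-replicate u false

-- Degrees 0 force all multiplicities to be 0, so the adjacency matrix is zero.
fullyReduced⇒kernel : ∀ {H} → FullyReduced H → ∀ c → Kernel H c
fullyReduced⇒kernel {H} red c v = sum-false λ u → cong (λ k → odd k ∧ c u) (mult≡0 u)
  where
  mult≡0 : ∀ u → mult H v u ≡ 0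
  mult≡0 u = sym (≤∧sum≡⇒≗ (λ _ → z≤n) (trans (Σℕ.sum-replicate-zero (order H)) (sym (red v))) u)

#isolated-fullyReduced : ∀ {H} → FullyReduced H → #isolated H ≡ order H
#isolated-fullyReduced {H} red =
  trans (cong length (filter-all (λ v → deg H v ℕ.≟ 0) (universal red (allFin (order H))))) (length-tabulate id)

kernel-xor : ∀ G {c d} → Kernel G c → Kernel G d → Kernel G (λ u → c u xor d u)
kernel-xor G {c} {d} kc kd v = trans (nbrs-xor G c d v) (cong₂ _xor_ (kc v) (kd v))

-- The basis lifts the unit vectors along `extends`, so the coefficients of a combination are its
-- values at the vertices `σ j`. This gives independence; for spanning, a channel and the
-- combination with its values along `σ` differ by an element of the kernel that `faithful` makes
-- zero.
restriction⇒dimension : ∀ {G H σ} → Restriction G H σ → (∀ d → Kernel H d) → HasDimension (𝒞 G) (order H)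
restriction⇒dimension {G} {H} {σ} R total = basis , record
  { independent = λ a lc≡∅ j → trans (sym (coordinate a j))
      (trans (cong (λ C → lookup C (σ j)) lc≡∅) (lookup-replicate (σ j) false))
  ; spanning    = λ C → lookup (proj₁ C) ∘ σ , spans C
  }
  where
  δ : Fin (order H) → Fin (order H) → Bool
  δ i j = does (i ≟ j)

  basis : Vector (Channel G) (order H)
  basis i = kernel⇒channel G (proj₁ (proj₂ (extends R (total (δ i)))))

  basis-σ : ∀ i j → lookup (proj₁ (basis i)) (σ j) ≡ δ i j
  basis-σ i j = trans (lookup∘tabulate _ (σ j)) (proj₂ (proj₂ (extends R (total (δ i)))) j)

  coordinate : ∀ a j → lookup (proj₁ (linearCombination (𝒞 G) a basis)) (σ j) ≡ a j
  coordinate a j = trans (lookup-linearCombination G a basis (σ j))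
    (trans (sum-cong-≗ λ i → trans (cong (a i ∧_) (basis-σ i j)) (∧-comm (a i) (δ i j))) (sum-indicator a j))

  spans : ∀ C → proj₁ (linearCombination (𝒞 G) (lookup (proj₁ C) ∘ σ) basis) ≡ proj₁ C
  spans C = lookup-injective λ u → xor-cancel (faithful R
    (kernel-xor G (channel⇒kernel G (linearCombination (𝒞 G) (c ∘ σ) basis)) (channel⇒kernel G C))
    (λ j → trans (cong (_xor c (σ j)) (coordinate (c ∘ σ) j)) (xor-same (c (σ j)))) u)
    where c = lookup (proj₁ C)

-- Uniqueness of dimension over 𝔽₂ by counting

funToFin-cong : ∀ {m n} {f g : Fin m → Fin n} → f ≗ g → funToFin f ≡ funToFin g
funToFin-cong {zero}  f≗g = refl
funToFin-cong {suc m} f≗g = cong₂ Fin.combine (f≗g zero) (funToFin-cong (f≗g ∘ suc))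

2^-cancel-≤ : ∀ {m n} → 2 ^ m ≤ 2 ^ n → m ≤ n
2^-cancel-≤ {m} {n} 2^m≤2^n = ℕ.≮⇒≥ λ n<m →
  contradiction 2^m≤2^n (ℕ.<⇒≱ (ℕ.^-monoʳ-< 2 (s≤s (s≤s z≤n)) n<m))

-- Up to pointwise equality, Boolean vectors of length `k` correspond to the elements of
-- `Fin (2 ^ k)`, so `f` becomes an injection of finite sets and the exponents can be compared.
≗-injective⇒≤ : ∀ {m n} (f : Vector Bool m → Vector Bool n) → (∀ {a b} → f a ≗ f b → a ≗ b) → m ≤ n
≗-injective⇒≤ {m} {n} f f-inj = 2^-cancel-≤ (injective⇒≤ {f = encode ∘ f ∘ decode} inj)
  where
  open Inverse 2↔Bool using (to; from; strictlyInverseˡ; strictlyInverseʳ)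
  decode : ∀ {k} → Fin (2 ^ k) → Vector Bool k
  decode i = to ∘ finToFun i
  encode : ∀ {k} → Vector Bool k → Fin (2 ^ k)
  encode a = funToFin (from ∘ a)
  decode-encode : ∀ {k} (a : Vector Bool k) → decode (encode a) ≗ a
  decode-encode a i = trans (cong to (finToFun-funToFin (from ∘ a) i)) (strictlyInverseˡ (a i))
  encode-decode : ∀ {k} (i : Fin (2 ^ k)) → encode (decode {k} i) ≡ i
  encode-decode {k} i = trans (funToFin-cong {k} (strictlyInverseʳ ∘ finToFun i)) (funToFin-finToFin {k} i)
  inj : Injective _≡_ _≡_ (encode ∘ f ∘ decode)
  inj {i} {j} eq = trans (sym (encode-decode {m} i)) (trans (funToFin-cong {m} (cong from ∘ f-inj λ k →
    trans (sym (decode-encode (f (decode i)) k))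
      (trans (cong (λ l → decode {n} l k) eq) (decode-encode (f (decode j)) k)))) (encode-decode {m} j))

module _ {m ℓm} (V : LeftModule ℤ/2 m ℓm) where
  open LeftModule V
  private module ΣV = CommutativeMonoidSum +ᴹ-commutativeMonoid

  linearCombination-cong : ∀ {n} {a a′ : Vector Bool n} b → a ≗ a′ →
    linearCombination V a b ≈ᴹ linearCombination V a′ b
  linearCombination-cong b a≗a′ = ΣV.sum-cong-≋ λ i → *ₗ-cong (a≗a′ i) ≈ᴹ-refl

  linearCombination-xor : ∀ {n} (a a′ : Vector Bool n) b →
    linearCombination V (λ i → a i xor a′ i) b ≈ᴹ linearCombination V a b +ᴹ linearCombination V a′ b
  linearCombination-xor a a′ b = ≈ᴹ-trans
    (ΣV.sum-cong-≋ λ i → *ₗ-distribʳ (b i) (a i) (a′ i))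
    (ΣV.∑-distrib-+ (λ i → a i *ₗ b i) (λ i → a′ i *ₗ b i))

  linearCombination-zero : ∀ {n} {a : Vector Bool n} b → (∀ i → a i ≡ false) →
    linearCombination V a b ≈ᴹ 0ᴹ
  linearCombination-zero {n} b a≡false = ≈ᴹ-trans
    (ΣV.sum-cong-≋ λ i → ≈ᴹ-trans (*ₗ-cong (a≡false i) ≈ᴹ-refl) (*ₗ-zeroˡ (b i)))
    (ΣV.sum-replicate-zero n)

  independent⇒injective : ∀ {n} {b : Vector Carrierᴹ n} → IsBasis V b → ∀ {a a′} →
    linearCombination V a b ≈ᴹ linearCombination V a′ b → a ≗ a′
  independent⇒injective {b = b} B {a} {a′} eq i = xor-cancel (IsBasis.independent B (λ i → a i xor a′ i)
    (≈ᴹ-trans (linearCombination-xor a a′ b)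
    (≈ᴹ-trans (+ᴹ-congʳ eq)
    -- In characteristic 2 the doubled combination is the one with coefficients `a′ i xor a′ i`, all
    -- `false`.
    (≈ᴹ-trans (≈ᴹ-sym (linearCombination-xor a′ a′ b))
              (linearCombination-zero b (xor-same ∘ a′))))) i)

  -- Each combination of `b` is sent to coordinates for it with respect to `b′`. Equal coordinates
  -- give equal combinations, hence equal coefficients by independence of `b`.
  dimension-≤ : ∀ {m n} → HasDimension V m → HasDimension V n → m ≤ n
  dimension-≤ (b , B) (b′ , B′) = ≗-injective⇒≤ coordinates λ {a} {a′} eq →
    independent⇒injective B
      (≈ᴹ-trans (≈ᴹ-sym (proj₂ (spanning (linearCombination V a b))))
      (≈ᴹ-trans (linearCombination-cong b′ eq) (proj₂ (spanning (linearCombination V a′ b)))))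
    where
    open IsBasis B′ using (spanning)
    coordinates : Vector Bool _ → Vector Bool _
    coordinates a = proj₁ (spanning (linearCombination V a b))

  dimension-unique : ∀ {m n} → HasDimension V m → HasDimension V n → m ≡ n
  dimension-unique p q = ℕ.≤-antisym (dimension-≤ p q) (dimension-≤ q p)

𝒞-dimension : ∀ {G H} → G ↝* H → FullyReduced H → HasDimension (𝒞 G) (#isolated H)
𝒞-dimension {G} {H} steps red = subst (HasDimension (𝒞 G)) (sym (#isolated-fullyReduced {H} red))
  (restriction⇒dimension (proj₂ (↝*-restriction steps)) (fullyReduced⇒kernel {H} red))

theorem6p3 : (G : Multigraph) → Reducible G →
    (∀ H → G ↝* H → FullyReduced H → HasDimension (𝒞 G) (#isolated H))
    × (∀ H₁ H₂ → G ↝* H₁ → FullyReduced H₁ → G ↝* H₂ → FullyReduced H₂ →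
    #isolated H₁ ≡ #isolated H₂)
theorem6p3 G _ =
    (λ _ → 𝒞-dimension)
  , (λ _ _ s₁ r₁ s₂ r₂ → dimension-unique (𝒞 G) (𝒞-dimension s₁ r₁) (𝒞-dimension s₂ r₂))
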